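{- Let $k$ and $n$ be positive integers. If $2<\frac{n}{k}\le 3$, then $$\nu_k(K_n)=\frac12\,(n-3)(n-2k).$$
   Context: A $k$-page book consists of $k$ halfplanes (pages) with a common boundary line (the spine). A $k$-page book drawing of a graph $G$ is a drawing of $G$ in a $k$-page book in which all vertices lie on the spine and edges do not cross the spine (each edge lies in one page). The $k$-page book crossing number $\nu_k(G)$ is the minimum number of edge-crossings over all $k$-page book drawings of $G$. Equivalently (convex model), $\nu_k(K_n)$ is the minimum, over all colorings of the edges of the complete geometric graph on the $n$ vertices of a convex polygon with $k$ colors, of the number of monochromatic crossings, i.e. pairs of edges of the same color that cross in their interiors. $K_n$ is the complete graph on $n$ vertices. -}

module Defs where

open import Data.Fin using (Fin; _<_; _<?_; _≟_)
open import Data.List using (List; allFin; cartesianProduct; filter; length; mapMaybe)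
open import Data.Maybe using (Maybe; just; nothing)
open import Data.Nat using (ℕ; _≤_)
open import Data.Product using (∃-syntax; _×_; _,_)
open import Relation.Binary.PropositionalEquality using (_≡_)
open import Relation.Nullary using (Dec; yes; no)
open import Relation.Nullary.Decidable using (_×-dec_)

-- The vertices of K_n are Fin n, in their order along the spine or, in the
-- convex model, in cyclic order around the polygon.  An edge is an unordered
-- pair of distinct vertices, stored with its smaller endpoint first; the proof
-- is irrelevant so that a colouring cannot depend on it.
record Edge (n : ℕ) : Set where
  constructor edge
  field
    lo hi  : Fin n
    .lo<hi : lo < hi

open Edge public using (lo; hi)

toEdge : ∀ {n} → Fin n × Fin n → Maybe (Edge n)
toEdge (i , j) with i <? j
... | yes i<j = just (edge i j i<j)
... | no  _   = nothing

edges : ∀ n → List (Edge n)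
edges n = mapMaybe toEdge (cartesianProduct (allFin n) (allFin n))

-- Two chords of a convex polygon meet in their interiors exactly when their
-- endpoints are four distinct vertices that alternate.  Naming first the chord
-- that contains the smallest of the four makes the relation asymmetric, so
-- each unordered pair of crossing edges is related in exactly one order.
Crosses : ∀ {n} → Edge n → Edge n → Set
Crosses e f = lo e < lo f × lo f < hi e × hi e < hi f

crosses? : ∀ {n} (e f : Edge n) → Dec (Crosses e f)
crosses? e f = (lo e <? lo f) ×-dec (lo f <? hi e) ×-dec (hi e <? hi f)

Colouring : ℕ → ℕ → Set
Colouring k n = Edge n → Fin k

MonoCrossing : ∀ {k n} → Colouring k n → Edge n × Edge n → Set
MonoCrossing χ (e , f) = Crosses e f × χ e ≡ χ f

monoCrossing? : ∀ {k n} (χ : Colouring k n) (p : Edge n × Edge n) →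
                Dec (MonoCrossing χ p)
monoCrossing? χ (e , f) = crosses? e f ×-dec (χ e ≟ χ f)

crossings : ∀ {k n} → Colouring k n → ℕ
crossings {n = n} χ =
  length (filter (monoCrossing? χ) (cartesianProduct (edges n) (edges n)))

-- ν is the k-page book crossing number of K_n, i.e. ν = ν_k(K_n): the minimum
-- of the number of monochromatic crossings over all k-colourings of the edges.
IsBookCrossingNumber : (k n ν : ℕ) → Set
IsBookCrossingNumber k n ν =
  (∃[ χ ] crossings {k} {n} χ ≡ ν) × (∀ (χ : Colouring k n) → ν ≤ crossings χ)

{-# OPTIONS --safe #-}

-- Only the n (n − 3) / 2 diagonals of the polygon can cross.  Lower bound: a
-- crossing-free set of diagonals of an n-gon has at most n − 3 elements, so
-- among the diagonals all but k (n − 3) can be charged to distinct monochromatic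
-- crossings.  For the count, give each colour the long side 0 (n − 1) as a
-- further chord and send a chord i j of a crossing-free family to an apex
-- strictly between i and j that no smaller chord hides; this is injective into
-- the n − 2 interior vertices.
--
-- Upper bound: colour the edge i j by its slope i + j mod n, each colour taking
-- two or three consecutive slopes.  Two consecutive slopes form a zigzag
-- triangulation with n − 3 diagonals and no crossing, and each diagonal of a
-- third slope crosses exactly one chord of the first, so both bounds agree.
module Submission where

open import Defs

module BookDrawings where

  open import Data.Fin as Fin using (Fin; toℕ; fromℕ; fromℕ<; zero)
  open import Data.Fin.Properties using (toℕ-injective; toℕ<n; toℕ-fromℕ; toℕ-fromℕ<; toℕ-inject₁)
  open import Data.List
    using (List; []; _∷_; _++_; length; map; mapMaybe; filter; cartesianProduct; allFin; upTo)
  open import Data.List.Extrema.Nat using (max; ⊥≤max; xs≤max; argmax-sel)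
  open import Data.List.Membership.Propositional using (_∈_; find; lose)
  open import Data.List.Membership.Propositional.Properties
    using (∈-∃++; ∈-++⁻; ∈-++⁺ˡ; ∈-++⁺ʳ; ∈-map⁻; ∈-map⁺; ∈-filter⁻; ∈-filter⁺; ∈-allFin;
           ∈-upTo⁺; ∈-upTo⁻; ∈-cartesianProduct⁺; ∈-cartesianProduct⁻)
  open import Data.List.Properties
    using (length-++; length-++-sucʳ; length-map; length-upTo; length-tabulate)
  open import Data.List.Relation.Unary.All as All using (All)
  open import Data.List.Relation.Unary.AllPairs using ([]; _∷_)
  open import Data.List.Relation.Unary.Any using (here; there; any?)
  open import Data.List.Relation.Unary.Unique.Propositional using (Unique)
  import Data.List.Relation.Unary.Unique.Propositional.Properties as Unique
  open import Data.Maybe using (Maybe; just; nothing)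
  open import Data.Nat
    using (ℕ; zero; suc; _+_; _*_; _∸_; _⊓_; _%_; _≤_; _<_; _≟_; _≤?_; _<?_; NonZero;
           z≤n; s≤s; s≤s⁻¹; z<s)
  open import Data.Nat.DivMod using (m<n⇒m%n≡m; m%n<n; [m+n]%n≡m%n)
  open import Data.Nat.Properties
  open import Data.Nat.Tactic.RingSolver using (solve-∀)
  open import Data.Product using (∃-syntax; _×_; _,_; proj₁; proj₂)
  open import Data.Product.Properties using (,-injectiveˡ)
  open import Data.Sum using (_⊎_; inj₁; inj₂)
  open import Data.Sum.Properties using (inj₁-injective; inj₂-injective)
  open import Function using (_∘_; id)
  open import Level using (0ℓ)
  open import Relation.Binary using (Rel; Decidable; tri<; tri≈; tri>)
  open import Relation.Binary.PropositionalEquality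
    using (_≡_; _≢_; refl; sym; trans; cong; cong₂; subst; subst₂; module ≡-Reasoning)
  open import Relation.Nullary using (¬_; Dec; yes; no; contradiction; contradiction-irr)
  open import Relation.Nullary.Decidable using (_×-dec_; ¬?)

  private variable
    A B : Set
    i j k m n p : ℕ

  -- Counting along injective relations.

  -- Pigeonhole for lists: deleting the partner of the head from `ys` still leaves partners for the
  -- later elements, since by injectivity none of them is related to the deleted one. A relation in
  -- place of a function lets `R` carry along what is known about each element.
  length-injection : (R : A → B → Set) (xs : List A) {ys : List B} → Unique xs →
                     (∀ {x} → x ∈ xs → ∃[ y ] (y ∈ ys × R x y)) →
                     (∀ {x x′ y} → R x y → R x′ y → x ≡ x′) →
                     length xs ≤ length ys
  length-injection R [] _ _ _ = z≤n
  length-injection R (x ∷ xs) (x∉xs ∷ xs!) total inj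
    with y , y∈ys , Rxy ← total (here refl)
    with us , vs , refl ← ∈-∃++ y∈ys =
    ≤-trans (s≤s (length-injection R xs xs! total′ inj))
            (≤-reflexive (sym (length-++-sucʳ us y vs)))
    where
    total′ : ∀ {x′} → x′ ∈ xs → ∃[ y′ ] (y′ ∈ us ++ vs × R x′ y′)
    total′ x′∈xs with total (there x′∈xs)
    ... | y′ , y′∈ , Rx′y′ with ∈-++⁻ us y′∈
    ...   | inj₁ y′∈us         = y′ , ∈-++⁺ˡ y′∈us , Rx′y′
    ...   | inj₂ (there y′∈vs) = y′ , ∈-++⁺ʳ us y′∈vs , Rx′y′
    ...   | inj₂ (here refl)   = contradiction (inj Rxy Rx′y′) (All.lookup x∉xs x′∈xs)

  length-cartesianProduct : (xs : List A) (ys : List B) →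
                            length (cartesianProduct xs ys) ≡ length xs * length ys
  length-cartesianProduct []       ys = refl
  length-cartesianProduct (x ∷ xs) ys =
    trans (length-++ (map (x ,_) ys))
          (cong₂ _+_ (length-map (x ,_) ys) (length-cartesianProduct xs ys))

  ∈-mapMaybe⁺ : (f : A → Maybe B) {xs : List A} {x : A} {y : B} →
                x ∈ xs → f x ≡ just y → y ∈ mapMaybe f xs
  ∈-mapMaybe⁺ f {x ∷ _} (here refl) eq with f x | eq
  ... | just _ | refl = here refl
  ∈-mapMaybe⁺ f {x ∷ _} (there x∈xs) eq with f x
  ... | just _  = there (∈-mapMaybe⁺ f x∈xs eq)
  ... | nothing = ∈-mapMaybe⁺ f x∈xs eq

  ∈-mapMaybe⁻ : (f : A → Maybe B) (xs : List A) {y : B} →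
                y ∈ mapMaybe f xs → ∃[ x ] (x ∈ xs × f x ≡ just y)
  ∈-mapMaybe⁻ f (x ∷ xs) y∈ with f x in eq
  ∈-mapMaybe⁻ f (x ∷ xs) (here refl) | just _ = x , here refl , eq
  ∈-mapMaybe⁻ f (x ∷ xs) (there y∈)  | just _ =
    let x′ , x′∈ , eq′ = ∈-mapMaybe⁻ f xs y∈ in x′ , there x′∈ , eq′
  ∈-mapMaybe⁻ f (x ∷ xs) y∈          | nothing =
    let x′ , x′∈ , eq′ = ∈-mapMaybe⁻ f xs y∈ in x′ , there x′∈ , eq′

  mapMaybe-unique⁺ : (f : A → Maybe B) →
                     (∀ {x x′ y} → f x ≡ just y → f x′ ≡ just y → x ≡ x′) →
                     {xs : List A} → Unique xs → Unique (mapMaybe f xs)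
  mapMaybe-unique⁺ f inj [] = []
  mapMaybe-unique⁺ f inj {x ∷ xs} (x∉xs ∷ xs!) with f x in eq
  ... | nothing = mapMaybe-unique⁺ f inj xs!
  ... | just y  = All.tabulate fresh ∷ mapMaybe-unique⁺ f inj xs!
    where
    fresh : ∀ {z} → z ∈ mapMaybe f xs → y ≢ z
    fresh z∈ refl with x′ , x′∈ , eq′ ← ∈-mapMaybe⁻ f xs z∈ =
      All.lookup x∉xs x′∈ (inj eq eq′)

  -- Greedy independent subsets and charged conflicts.

  -- The accounting behind `bound` is that each element left out of `members` pays with a conflict
  -- of its own. Both ends of every conflict stay inside `xs`, which is what makes a conflict
  -- involving a new head fresh.
  record IndependentSubset (R : Rel A 0ℓ) (xs : List A) : Set where
    field
      members     : List A
      members!    : Unique members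
      members⊆    : ∀ {x} → x ∈ members → x ∈ xs
      independent : ∀ {x y} → x ∈ members → y ∈ members → ¬ R x y
      conflicts   : List (A × A)
      conflicts!  : Unique conflicts
      conflicts⊆  : ∀ {x y} → (x , y) ∈ conflicts → x ∈ xs × y ∈ xs × R x y
      bound       : length xs ≤ length members + length conflicts

  module _ {R : Rel A 0ℓ} where

    open IndependentSubset

    choose : {x : A} {xs : List A} → ¬ R x x → All (x ≢_) xs →
             (I : IndependentSubset R xs) →
             (∀ {y} → y ∈ members I → ¬ R x y) → (∀ {y} → y ∈ members I → ¬ R y x) →
             IndependentSubset R (x ∷ xs)
    choose {x} {xs} ¬Rxx x∉xs I ¬Rx ¬xR = record
      { members     = x ∷ members I
      ; members!    = All.tabulate (All.lookup x∉xs ∘ members⊆ I) ∷ members! I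
      ; members⊆    = λ { (here refl) → here refl ; (there y∈) → there (members⊆ I y∈) }
      ; independent = λ
          { (here refl) (here refl) → ¬Rxx
          ; (here refl) (there z∈)  → ¬Rx z∈
          ; (there y∈)  (here refl) → ¬xR y∈
          ; (there y∈)  (there z∈)  → independent I y∈ z∈ }
      ; conflicts   = conflicts I
      ; conflicts!  = conflicts! I
      ; conflicts⊆  = λ p∈ → let y∈ , z∈ , Ryz = conflicts⊆ I p∈ in there y∈ , there z∈ , Ryz
      ; bound       = s≤s (bound I)
      }

    -- Earlier conflicts lie inside `xs`, so a pair with an end outside `xs` is not among them. The
    -- order of `y` and `z` is left open because the new element may be either end of the related
    -- pair.
    charge : {x : A} {xs : List A} → (I : IndependentSubset R xs) →
             ∀ y z → ¬ (y ∈ xs × z ∈ xs) → y ∈ x ∷ xs → z ∈ x ∷ xs → R y z →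
             IndependentSubset R (x ∷ xs)
    charge I y z new y∈ z∈ Ryz = record
      { members     = members I
      ; members!    = members! I
      ; members⊆    = there ∘ members⊆ I
      ; independent = independent I
      ; conflicts   = (y , z) ∷ conflicts I
      ; conflicts!  = All.tabulate (λ { p∈ refl → let y∈′ , z∈′ , _ = conflicts⊆ I p∈ in new (y∈′ , z∈′) })
                      ∷ conflicts! I
      ; conflicts⊆  = λ
          { (here refl) → y∈ , z∈ , Ryz
          ; (there p∈)  → let y∈′ , z∈′ , R′ = conflicts⊆ I p∈ in there y∈′ , there z∈′ , R′ }
      ; bound       = ≤-trans (s≤s (bound I)) (≤-reflexive (sym (+-suc _ _)))
      }

    -- Greedy choice: an element in conflict with one already chosen is charged to
    -- that conflict, which involves no later element and so is charged only once.
    independentSubset : Decidable R → (∀ {x} → ¬ R x x) →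
                        (xs : List A) → Unique xs → IndependentSubset R xs
    independentSubset R? irr [] [] = record
      { members = [] ; members! = [] ; members⊆ = λ () ; independent = λ ()
      ; conflicts = [] ; conflicts! = [] ; conflicts⊆ = λ () ; bound = z≤n }
    independentSubset R? irr (x ∷ xs) (x∉xs ∷ xs!) with independentSubset R? irr xs xs!
    ... | I with any? (R? x) (members I) | any? (λ y → R? y x) (members I)
    ...   | yes Rx | _ =
            let y , y∈ , Rxy = find Rx in
            charge I x y (λ (x∈ , _) → All.lookup x∉xs x∈ refl) (here refl) (there (members⊆ I y∈)) Rxy
    ...   | no _ | yes xR =
            let y , y∈ , Ryx = find xR in
            charge I y x (λ (_ , x∈) → All.lookup x∉xs x∈ refl) (there (members⊆ I y∈)) (here refl) Ryx
    ...   | no ¬Rx | no ¬xR =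
            choose irr x∉xs I (λ y∈ Rxy → ¬Rx (lose y∈ Rxy)) (λ y∈ Ryx → ¬xR (lose y∈ Ryx))

  -- Edges and monochromatic crossings as duplicate-free lists.

  start end : Edge n → ℕ
  start e = toℕ (lo e)
  end   e = toℕ (hi e)

  edge-≡ : {e f : Edge n} → start e ≡ start f → end e ≡ end f → e ≡ f
  edge-≡ {e = edge _ _ _} {f = edge _ _ _} l≡ h≡ with toℕ-injective l≡ | toℕ-injective h≡
  ... | refl | refl = refl

  toEdge-lo-hi : (e : Edge n) → toEdge (lo e , hi e) ≡ just e
  toEdge-lo-hi (edge i j i<j) with i Fin.<? j
  ... | yes _  = refl
  ... | no i≮j = contradiction-irr i<j i≮j

  toEdge-just : ∀ {p} {e : Edge n} → toEdge p ≡ just e → p ≡ (lo e , hi e)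
  toEdge-just {p = i , j} eq with i Fin.<? j
  toEdge-just refl | yes _ = refl

  ∈-edges : (e : Edge n) → e ∈ edges n
  ∈-edges e = ∈-mapMaybe⁺ toEdge (∈-cartesianProduct⁺ (∈-allFin _) (∈-allFin _)) (toEdge-lo-hi e)

  edges! : Unique (edges n)
  edges! {n} = mapMaybe-unique⁺ toEdge
    (λ eq eq′ → trans (toEdge-just eq) (sym (toEdge-just eq′)))
    (Unique.cartesianProduct⁺ (Unique.allFin⁺ n) (Unique.allFin⁺ n))

  -- By computation `crossings χ` is the length of this list.
  monoCrossings : Colouring k n → List (Edge n × Edge n)
  monoCrossings χ = filter (monoCrossing? χ) (cartesianProduct (edges _) (edges _))

  monoCrossings! : (χ : Colouring k n) → Unique (monoCrossings χ)
  monoCrossings! χ = Unique.filter⁺ (monoCrossing? χ) (Unique.cartesianProduct⁺ edges! edges!)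

  ∈-monoCrossings⁺ : (χ : Colouring k n) {p : Edge n × Edge n} →
                     MonoCrossing χ p → p ∈ monoCrossings χ
  ∈-monoCrossings⁺ χ = ∈-filter⁺ (monoCrossing? χ) (∈-cartesianProduct⁺ (∈-edges _) (∈-edges _))

  ∈-monoCrossings⁻ : (χ : Colouring k n) {p : Edge n × Edge n} →
                     p ∈ monoCrossings χ → MonoCrossing χ p
  ∈-monoCrossings⁻ χ p∈ =
    proj₂ (∈-filter⁻ (monoCrossing? χ) {xs = cartesianProduct (edges _) (edges _)} p∈)

  -- Bounding non-crossing families of coloured chords.

  Long : Edge n → Set
  Long e = 2 + start e ≤ end e

  module Apex (S : List (Fin k × Edge (2 + m))) where

    Inner : Fin k × Edge (2 + m) → Fin k × Edge (2 + m) → Set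
    Inner (c , e) (d , f) = c ≡ d × start e ≡ start f × end f < end e

    inner? : Decidable Inner
    inner? (c , e) (d , f) = (c Fin.≟ d) ×-dec (start e ≟ start f) ×-dec (end f <? end e)

    innerEnds : Fin k × Edge (2 + m) → List ℕ
    innerEnds x = map (end ∘ proj₂) (filter (inner? x) S)

    -- In a triangulation this is the third vertex of the triangle below the chord: the far end of
    -- the longest chord of the same colour that shares the start and lies inside. The default, one
    -- past the start, stands for the side of the polygon leaving that vertex.
    apex : Fin k × Edge (2 + m) → ℕ
    apex x = max (suc (start (proj₂ x))) (innerEnds x)

    start<apex : ∀ x → start (proj₂ x) < apex x
    start<apex x = ⊥≤max _ (innerEnds x)

    inner-end≤apex : ∀ {x y} → y ∈ S → Inner x y → end (proj₂ y) ≤ apex x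
    inner-end≤apex {x} y∈ I =
      All.lookup (xs≤max _ (innerEnds x)) (∈-map⁺ (end ∘ proj₂) (∈-filter⁺ (inner? x) y∈ I))

    apex-cases : ∀ x → apex x ≡ suc (start (proj₂ x)) ⊎
                       (∃[ y ] (y ∈ S × Inner x y × apex x ≡ end (proj₂ y)))
    apex-cases x with argmax-sel id (suc (start (proj₂ x))) (innerEnds x)
    ... | inj₁ eq = inj₁ eq
    ... | inj₂ a∈ with y , y∈ , eq ← ∈-map⁻ (end ∘ proj₂) a∈ =
      let y∈S , I = ∈-filter⁻ (inner? x) {xs = S} y∈ in inj₂ (y , y∈S , I , eq)

    module _ (long : ∀ {c e} → (c , e) ∈ S → Long e)
             (noncrossing : ∀ {c e f} → (c , e) ∈ S → (c , f) ∈ S → ¬ Crosses e f) where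

      apex<end : ∀ {c e} → (c , e) ∈ S → apex (c , e) < end e
      apex<end {c} {e} x∈ with apex-cases (c , e)
      ... | inj₁ eq = subst (_< _) (sym eq) (long x∈)
      ... | inj₂ (_ , _ , (_ , _ , lt) , eq) = subst (_< _) (sym eq) lt

      -- A start of `f` strictly between `start e` and the apex makes `f` cross the inner chord that
      -- reaches the apex; for the default apex there is no vertex in between. An end of `f` between
      -- the apex and `end e` makes `f` cross `e` or, if both start at the same vertex, makes `f` an
      -- inner chord of `e` that reaches beyond the apex.
      encloses : ∀ {c e f} → (c , e) ∈ S → (c , f) ∈ S →
                 start f < apex (c , e) → apex (c , e) < end f →
                 start f ≤ start e × end e ≤ end f
      encloses {c} {e} {f} e∈ f∈ sf<a a<ef = sf≤se , ee≤ef
        where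
        sf≤se : start f ≤ start e
        sf≤se with apex-cases (c , e)
        ... | inj₁ eq = s≤s⁻¹ (subst (start f <_) eq sf<a)
        ... | inj₂ ((_ , g) , g∈ , (refl , se≡sg , _) , eq) = ≮⇒≥ λ se<sf →
          noncrossing g∈ f∈ (subst (_< start f) se≡sg se<sf , subst (start f <_) eq sf<a ,
                             subst (_< end f) eq a<ef)
        ee≤ef : end e ≤ end f
        ee≤ef = ≮⇒≥ λ ef<ee → case-≤ ef<ee (m≤n⇒m<n∨m≡n sf≤se)
          where
          case-≤ : end f < end e → ¬ (start f < start e ⊎ start f ≡ start e)
          case-≤ ef<ee (inj₁ sf<se) =
            noncrossing f∈ e∈ (sf<se , <-trans (start<apex (c , e)) a<ef , ef<ee)
          case-≤ ef<ee (inj₂ sf≡se) =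
            <⇒≱ a<ef (inner-end≤apex {x = c , e} f∈ (refl , sym sf≡se , ef<ee))

      -- A common apex lies strictly inside both chords, so each encloses the other.
      apex-injective : ∀ {c e f} → (c , e) ∈ S → (c , f) ∈ S → apex (c , e) ≡ apex (c , f) → e ≡ f
      apex-injective {c} {e} {f} e∈ f∈ eq =
        let sf≤se , ee≤ef = encloses e∈ f∈ (subst (start f <_) (sym eq) (start<apex (c , f)))
                                           (subst (_< end f) (sym eq) (apex<end f∈))
            se≤sf , ef≤ee = encloses f∈ e∈ (subst (start e <_) eq (start<apex (c , e)))
                                           (subst (_< end e) eq (apex<end e∈))
        in edge-≡ (≤-antisym se≤sf sf≤se) (≤-antisym ee≤ef ef≤ee)

      length-noncrossing : Unique S → length S ≤ k * m
      length-noncrossing S! = subst (length S ≤_)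
        (trans (length-cartesianProduct (allFin k) (upTo m))
               (cong₂ _*_ (length-tabulate {n = k} id) (length-upTo m)))
        (length-injection R S S! total inj)
        where
        -- Membership in `S` is part of `R` because apexes are injective only within the family. An
        -- apex exceeds a start, so it is positive, and it is below an end, which is at most
        -- `1 + m`; writing it as `suc a` gives `a < m`.
        R : Fin k × Edge (2 + m) → Fin k × ℕ → Set
        R x (d , a) = x ∈ S × proj₁ x ≡ d × apex x ≡ suc a
        total : ∀ {x} → x ∈ S → ∃[ y ] (y ∈ cartesianProduct (allFin k) (upTo m) × R x y)
        total {c , e} x∈ with apex (c , e) | start<apex (c , e) | apex<end x∈
        ... | suc a | _ | a<end =
          (c , a) , ∈-cartesianProduct⁺ (∈-allFin c)
                      (∈-upTo⁺ (s≤s⁻¹ (≤-trans a<end (s≤s⁻¹ (toℕ<n (hi e))))))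
                  , x∈ , refl , refl
        inj : ∀ {x x′ y} → R x y → R x′ y → x ≡ x′
        inj (x∈ , refl , eq) (x′∈ , refl , eq′) =
          cong (_ ,_) (apex-injective x∈ x′∈ (trans eq (sym eq′)))

  -- The lower bound for an arbitrary colouring.

  module _ (χ : Colouring k (3 + m)) (D : List (Edge (3 + m))) (D! : Unique D)
           (long : ∀ {e} → e ∈ D → Long e)
           (proper : ∀ {e} → e ∈ D → ¬ (start e ≡ 0 × end e ≡ 2 + m)) where

    Conflict : Rel (Edge (3 + m)) _
    Conflict e f = MonoCrossing χ (e , f)

    -- The greedy subset splits the count of `D` into chords bounded by the apex argument and chords
    -- paid for by distinct monochromatic crossings.
    crossings-bound : length D ≤ k * m + crossings χ
    crossings-bound = ≤-trans bound (+-mono-≤ members-bound conflicts-bound)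
      where
      open IndependentSubset
        (independentSubset {R = Conflict} (λ e f → monoCrossing? χ (e , f))
          (λ ((lo<lo , _) , _) → <-irrefl refl lo<lo) D D!)

      conflicts-bound : length conflicts ≤ crossings χ
      conflicts-bound = length-injection _≡_ conflicts conflicts!
        (λ p∈ → _ , ∈-monoCrossings⁺ χ (proj₂ (proj₂ (conflicts⊆ p∈))) , refl)
        (λ eq eq′ → trans eq (sym eq′))

      base : Edge (3 + m)
      base = edge zero (fromℕ (2 + m)) z<s

      end-base : end base ≡ 2 + m
      end-base = toℕ-fromℕ (2 + m)

      coloured = map (λ e → χ e , e) members
      -- One copy of the long side per colour uses up one of the `1 + m` interior vertices available
      -- to that colour, which lowers the bound from `k * suc m` to `k * m`.
      bases    = map (_, base) (allFin k)
      family   = coloured ++ bases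

      ∈-family⁻ : ∀ {c e} → (c , e) ∈ family → (e ∈ members × c ≡ χ e) ⊎ e ≡ base
      ∈-family⁻ x∈ with ∈-++⁻ coloured x∈
      ... | inj₁ x∈₁ with _ , e∈ , refl ← ∈-map⁻ (λ e → χ e , e) x∈₁ = inj₁ (e∈ , refl)
      ... | inj₂ x∈₂ with _ , _ , refl ← ∈-map⁻ (_, base) x∈₂ = inj₂ refl

      family! : Unique family
      family! = Unique.++⁺ (Unique.map⁺ (cong proj₂) members!)
        (Unique.map⁺ (cong proj₁) (Unique.allFin⁺ k)) disjoint
        where
        disjoint : ∀ {x} → ¬ (x ∈ coloured × x ∈ bases)
        disjoint (x∈₁ , x∈₂) with ∈-map⁻ (λ e → χ e , e) x∈₁ | ∈-map⁻ (_, base) x∈₂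
        ... | _ , e∈ , refl | _ , _ , refl = proper (members⊆ e∈) (refl , end-base)

      family-long : ∀ {c e} → (c , e) ∈ family → Long e
      family-long x∈ with ∈-family⁻ x∈
      ... | inj₁ (e∈ , _) = long (members⊆ e∈)
      ... | inj₂ refl     = subst (2 ≤_) (sym end-base) (s≤s (s≤s z≤n))

      family-noncrossing : ∀ {c e f} → (c , e) ∈ family → (c , f) ∈ family → ¬ Crosses e f
      family-noncrossing {e = e} {f} x∈ y∈ ef@(lo<lo , _ , hi<hi) with ∈-family⁻ x∈ | ∈-family⁻ y∈
      ... | inj₁ (e∈ , eq) | inj₁ (f∈ , eq′) = independent e∈ f∈ (ef , trans (sym eq) eq′)
      -- No chord ends beyond the last vertex or starts before `0`, so `base` crosses nothing in
      -- either position.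
      ... | inj₂ refl | _ = <⇒≱ (subst (_< end f) end-base hi<hi) (s≤s⁻¹ (toℕ<n (hi f)))
      ... | _ | inj₂ refl = n≮0 lo<lo

      members-bound : length members ≤ k * m
      members-bound = +-cancelʳ-≤ k _ _ (begin
        length members + k
          ≡⟨ cong₂ _+_ (length-map _ members) length-bases ⟨
        length coloured + length bases
          ≡⟨ length-++ coloured ⟨
        length family
          ≤⟨ Apex.length-noncrossing family family-long family-noncrossing family! ⟩
        k * suc m
          ≡⟨ *-suc k m ⟩
        k + k * m
          ≡⟨ +-comm k _ ⟩
        k * m + k
          ∎)
        where
        open ≤-Reasoning
        length-bases : length bases ≡ k
        length-bases = trans (length-map _ (allFin k)) (length-tabulate {n = k} id)

  -- Counting the diagonals of a convex polygon.

  Diagonal : ℕ → ℕ → ℕ → Set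
  Diagonal n i j = 2 + i ≤ j × ¬ (i ≡ 0 × suc j ≡ n)

  diagonal? : ∀ n i j → Dec (Diagonal n i j)
  diagonal? n i j = (2 + i ≤? j) ×-dec ¬? ((i ≟ 0) ×-dec (suc j ≟ n))

  -- The non-adjacent pairs on a path with `2 + q` vertices; the recursion appends one vertex to the
  -- path.
  longPairs : ℕ → List (ℕ × ℕ)
  longPairs zero    = []
  longPairs (suc q) = map (_, 2 + q) (upTo (suc q)) ++ longPairs q

  ∈-longPairs⁺ : ∀ q → 2 + i ≤ j → j < 2 + q → (i , j) ∈ longPairs q
  ∈-longPairs⁺ zero    i<j j<2 = contradiction (≤-trans i<j (s≤s⁻¹ j<2)) λ { (s≤s ()) }
  ∈-longPairs⁺ (suc q) i<j j<3+q with m≤n⇒m<n∨m≡n (s≤s⁻¹ j<3+q)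
  ... | inj₁ j<2+q = ∈-++⁺ʳ _ (∈-longPairs⁺ q i<j j<2+q)
  ... | inj₂ refl  = ∈-++⁺ˡ (∈-map⁺ _ (∈-upTo⁺ (s≤s⁻¹ i<j)))

  ∈-longPairs⁻ : ∀ q → (i , j) ∈ longPairs q → 2 + i ≤ j × j < 2 + q
  ∈-longPairs⁻ (suc q) p∈ with ∈-++⁻ (map (_, 2 + q) (upTo (suc q))) p∈
  ... | inj₁ p∈₁ with _ , i∈ , refl ← ∈-map⁻ (_, 2 + q) p∈₁ = s≤s (∈-upTo⁻ i∈) , ≤-refl
  ... | inj₂ p∈₂ = let i<j , j< = ∈-longPairs⁻ q p∈₂ in i<j , m≤n⇒m≤1+n j<

  longPairs! : ∀ q → Unique (longPairs q)
  longPairs! zero    = []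
  longPairs! (suc q) = Unique.++⁺ (Unique.map⁺ ,-injectiveˡ (Unique.upTo⁺ (suc q))) (longPairs! q) disjoint
    where
    disjoint : ∀ {x} → ¬ (x ∈ map (_, 2 + q) (upTo (suc q)) × x ∈ longPairs q)
    disjoint (x∈₁ , x∈₂) with _ , _ , refl ← ∈-map⁻ (_, 2 + q) x∈₁ = <-irrefl refl (proj₂ (∈-longPairs⁻ q x∈₂))

  length-longPairs : ∀ q → length (longPairs q) * 2 ≡ q * suc q
  length-longPairs zero    = refl
  length-longPairs (suc q) = begin
    length (longPairs (suc q)) * 2  ≡⟨ cong (_* 2) (length-++ row) ⟩
    (length row + L) * 2            ≡⟨ cong (λ l → (l + L) * 2) length-row ⟩
    (suc q + L) * 2                 ≡⟨ *-distribʳ-+ 2 (suc q) L ⟩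
    suc q * 2 + L * 2               ≡⟨ cong (suc q * 2 +_) (length-longPairs q) ⟩
    suc q * 2 + q * suc q           ≡⟨ step q ⟩
    suc q * suc (suc q)             ∎
    where
    open ≡-Reasoning
    row = map (_, 2 + q) (upTo (suc q))
    L = length (longPairs q)
    length-row : length row ≡ suc q
    length-row = trans (length-map _ (upTo (suc q))) (length-upTo (suc q))
    step : ∀ q → suc q * 2 + q * suc q ≡ suc q * suc (suc q)
    step = solve-∀

  -- The last vertex `2 + p` of the polygon is adjacent to `0`, so its diagonals begin at `1`.
  lastRow : ℕ → List (ℕ × ℕ)
  lastRow p = map (λ i → suc i , 2 + p) (upTo p)

  -- The diagonals of a polygon with 3 + p vertices.
  diagonals : ℕ → List (ℕ × ℕ)
  diagonals p = lastRow p ++ longPairs p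

  ∈-diagonals⁺ : Diagonal (3 + p) i j → j < 3 + p → (i , j) ∈ diagonals p
  ∈-diagonals⁺ {p} (i<j , proper) j<3+p with m≤n⇒m<n∨m≡n (s≤s⁻¹ j<3+p)
  ... | inj₁ j<2+p = ∈-++⁺ʳ _ (∈-longPairs⁺ p i<j j<2+p)
  ∈-diagonals⁺ {i = zero}  (_ , proper) _ | inj₂ refl = contradiction (refl , refl) proper
  ∈-diagonals⁺ {i = suc i} (i<j , _)    _ | inj₂ refl =
    ∈-++⁺ˡ (∈-map⁺ _ (∈-upTo⁺ (s≤s⁻¹ (s≤s⁻¹ i<j))))

  ∈-diagonals⁻ : (i , j) ∈ diagonals p → Diagonal (3 + p) i j × j < 3 + p
  ∈-diagonals⁻ {p = p} d∈ with ∈-++⁻ (lastRow p) d∈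
  ... | inj₁ d∈₁ with _ , i∈ , refl ← ∈-map⁻ (λ i → suc i , 2 + p) d∈₁ =
          (s≤s (s≤s (∈-upTo⁻ i∈)) , λ ()) , ≤-refl
  ... | inj₂ d∈₂ = let i<j , j< = ∈-longPairs⁻ p d∈₂ in
          (i<j , λ (_ , eq) → <-irrefl (suc-injective eq) j<) , m≤n⇒m≤1+n j<

  diagonals! : ∀ p → Unique (diagonals p)
  diagonals! p = Unique.++⁺ (Unique.map⁺ (suc-injective ∘ ,-injectiveˡ) (Unique.upTo⁺ p)) (longPairs! p) disjoint
    where
    disjoint : ∀ {x} → ¬ (x ∈ lastRow p × x ∈ longPairs p)
    disjoint (x∈₁ , x∈₂) with _ , _ , refl ← ∈-map⁻ (λ i → suc i , 2 + p) x∈₁ =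
      <-irrefl refl (proj₂ (∈-longPairs⁻ p x∈₂))

  length-diagonals : ∀ p → length (diagonals p) * 2 ≡ p * (3 + p)
  length-diagonals p = begin
    length (diagonals p) * 2      ≡⟨ cong (_* 2) (length-++ (lastRow p)) ⟩
    (length (lastRow p) + L) * 2  ≡⟨ cong (λ l → (l + L) * 2) length-lastRow ⟩
    (p + L) * 2                   ≡⟨ *-distribʳ-+ 2 p L ⟩
    p * 2 + L * 2                 ≡⟨ cong (p * 2 +_) (length-longPairs p) ⟩
    p * 2 + p * suc p             ≡⟨ *-distribˡ-+ p 2 (suc p) ⟨
    p * (3 + p)                   ∎
    where
    open ≡-Reasoning
    L = length (longPairs p)
    length-lastRow : length (lastRow p) ≡ p
    length-lastRow = trans (length-map _ (upTo p)) (length-upTo p)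

  edgeDiagonal? : (e : Edge n) → Dec (Diagonal n (start e) (end e))
  edgeDiagonal? {n} e = diagonal? n (start e) (end e)

  diagonalEdges : ∀ n → List (Edge n)
  diagonalEdges n = filter edgeDiagonal? (edges n)

  ∈-diagonalEdges⁺ : {e : Edge n} → Diagonal n (start e) (end e) → e ∈ diagonalEdges n
  ∈-diagonalEdges⁺ {e = e} = ∈-filter⁺ edgeDiagonal? (∈-edges e)

  ∈-diagonalEdges⁻ : {e : Edge n} → e ∈ diagonalEdges n → Diagonal n (start e) (end e)
  ∈-diagonalEdges⁻ {n} e∈ = proj₂ (∈-filter⁻ edgeDiagonal? {xs = edges n} e∈)

  -- Transfers the explicit count of pairs to the list of edges on which `crossings-bound` operates.
  diagonals≤diagonalEdges : ∀ p → length (diagonals p) ≤ length (diagonalEdges (3 + p))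
  diagonals≤diagonalEdges p = length-injection R (diagonals p) (diagonals! p) total
    λ (s≡ , e≡) (s≡′ , e≡′) → cong₂ _,_ (trans (sym s≡) s≡′) (trans (sym e≡) e≡′)
    where
    R : ℕ × ℕ → Edge (3 + p) → Set
    R (i , j) e = start e ≡ i × end e ≡ j
    total : ∀ {d} → d ∈ diagonals p → ∃[ e ] (e ∈ diagonalEdges (3 + p) × R d e)
    total {i , j} d∈ with D@(i<j , _) , j<n ← ∈-diagonals⁻ {i} {j} d∈ =
      e , ∈-diagonalEdges⁺ (subst₂ (Diagonal _) (sym s≡i) (sym e≡j) D) , s≡i , e≡j
      where
      i<n : i < 3 + p
      i<n = <-trans (<⇒≤ i<j) j<n
      s≡i : toℕ (fromℕ< i<n) ≡ i
      s≡i = toℕ-fromℕ< i<n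
      e≡j : toℕ (fromℕ< j<n) ≡ j
      e≡j = toℕ-fromℕ< j<n
      e : Edge (3 + p)
      e = edge (fromℕ< i<n) (fromℕ< j<n) (subst₂ _<_ (sym s≡i) (sym e≡j) (<⇒≤ i<j))

  lower-bound : (χ : Colouring k (3 + p)) → length (diagonals p) ≤ k * p + crossings χ
  lower-bound {p = p} χ = ≤-trans (diagonals≤diagonalEdges p)
    (crossings-bound χ (diagonalEdges (3 + p)) (Unique.filter⁺ edgeDiagonal? edges!)
      (proj₁ ∘ ∈-diagonalEdges⁻)
      (λ e∈ (s≡ , e≡) → proj₂ (∈-diagonalEdges⁻ e∈) (s≡ , cong suc e≡)))

  -- Slopes modulo n and crossings between nearby slopes.

  -- Turns slope bounds into equalities: two endpoints that each advance by at least one and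
  -- together by at most two advance by exactly one each.
  squeeze : ∀ {a b c d} → a ≤ b → c ≤ d → b + d ≤ a + c → a ≡ b × c ≡ d
  squeeze {a} {b} {c} {d} a≤b c≤d sum =
    ≤-antisym a≤b (+-cancelʳ-≤ c b a (≤-trans (+-monoʳ-≤ b c≤d) sum)) ,
    ≤-antisym c≤d (+-cancelˡ-≤ a d c (≤-trans (+-monoˡ-≤ d a≤b) sum))

  halve : ∀ x → ∃[ h ] (x ≡ h + h ⊎ x ≡ suc (h + h))
  halve zero    = 0 , inj₁ refl
  halve (suc x) with halve x
  ... | h , inj₁ refl = h , inj₂ refl
  ... | h , inj₂ refl = suc h , inj₁ (cong suc (sym (+-suc h h)))

  [n+m]%n≡m : ∀ {n m} .{{_ : NonZero n}} → m < n → (n + m) % n ≡ m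
  [n+m]%n≡m {n} {m} m<n = begin
    (n + m) % n  ≡⟨ cong (_% n) (+-comm n m) ⟩
    (m + n) % n  ≡⟨ [m+n]%n≡m%n m n ⟩
    m % n        ≡⟨ m<n⇒m%n≡m m<n ⟩
    m            ∎
    where open ≡-Reasoning

  %-cases : ∀ {n x} .{{_ : NonZero n}} → x < n + n →
            (x < n × x % n ≡ x) ⊎ (n ≤ x × n + x % n ≡ x)
  %-cases {n} {x} x<2n with x <? n
  ... | yes x<n = inj₁ (x<n , m<n⇒m%n≡m x<n)
  ... | no x≮n with y , refl ← m≤n⇒∃[o]m+o≡n (≮⇒≥ x≮n) =
    inj₂ (≮⇒≥ x≮n , cong (n +_) ([n+m]%n≡m (+-cancelˡ-< n y n x<2n)))

  slope : (n : ℕ) .{{_ : NonZero n}} → ℕ → ℕ → ℕ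
  slope n i j = (i + j) % n

  -- Chords whose slopes differ by at most 2 cross only if one is the other
  -- shifted by one step around the polygon; in the second case the shift wraps
  -- around, which exchanges the endpoints.
  crossing-slopes : ∀ {n a b c d} .{{_ : NonZero n}} → a < b → b < c → c < d → d < n →
    slope n b d ≤ 2 + slope n a c → slope n a c ≤ 2 + slope n b d →
    (suc a ≡ b × suc c ≡ d × slope n b d ≡ 2 + slope n a c) ⊎
    (a ≡ 0 × suc b ≡ c × suc d ≡ n × slope n a c ≡ 2 + slope n b d)
  crossing-slopes {n} {a} {b} {c} {d} a<b b<c c<d d<n t≤2+s s≤2+t
    with %-cases {n} {a + c} (+-mono-< (<-trans a<b (<-trans b<c (<-trans c<d d<n))) (<-trans c<d d<n))
       | %-cases {n} {b + d} (+-mono-< (<-trans b<c (<-trans c<d d<n)) d<n)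
  ... | inj₁ (_ , s≡) | inj₁ (_ , t≡) = inj₁ (proj₁ eqs , proj₂ eqs , t≡2+s)
    where
    eqs = squeeze a<b c<d (begin
      b + d              ≡⟨ t≡ ⟨
      slope n b d        ≤⟨ t≤2+s ⟩
      2 + slope n a c    ≡⟨ cong (2 +_) s≡ ⟩
      2 + (a + c)        ≡⟨ cong suc (+-suc a c) ⟨
      suc a + suc c      ∎)
      where open ≤-Reasoning
    t≡2+s = begin
      slope n b d        ≡⟨ t≡ ⟩
      b + d              ≡⟨ cong₂ _+_ (proj₁ eqs) (proj₂ eqs) ⟨
      suc a + suc c      ≡⟨ cong suc (+-suc a c) ⟩
      2 + (a + c)        ≡⟨ cong (2 +_) s≡ ⟨
      2 + slope n a c    ∎
      where open ≡-Reasoning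
  ... | inj₂ (_ , s≡) | inj₂ (_ , t≡) = inj₁ (proj₁ eqs , proj₂ eqs , t≡2+s)
    where
    shift : n + (2 + slope n a c) ≡ suc a + suc c
    shift = begin
      n + (2 + slope n a c)  ≡⟨ +-comm n _ ⟩
      2 + slope n a c + n    ≡⟨ cong (2 +_) (trans (+-comm _ n) s≡) ⟩
      2 + (a + c)            ≡⟨ cong suc (+-suc a c) ⟨
      suc a + suc c          ∎
      where open ≡-Reasoning
    eqs = squeeze a<b c<d (begin
      b + d                  ≡⟨ t≡ ⟨
      n + slope n b d        ≤⟨ +-monoʳ-≤ n t≤2+s ⟩
      n + (2 + slope n a c)  ≡⟨ shift ⟩
      suc a + suc c          ∎)
      where open ≤-Reasoning
    t≡2+s = +-cancelˡ-≡ n _ _ (trans t≡ (trans (sym (cong₂ _+_ (proj₁ eqs) (proj₂ eqs))) (sym shift)))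
  ... | inj₂ (n≤a+c , _) | inj₁ (b+d<n , _) =
    contradiction (<-≤-trans (+-mono-< a<b c<d) (≤-trans (<⇒≤ b+d<n) n≤a+c)) (<-irrefl refl)
  -- Only `b + d` wraps around. The inequalities squeezed are `suc b ≤ c` and `suc d ≤ n + a`; since
  -- `suc d ≤ n`, equality in the second also forces `a ≡ 0`.
  ... | inj₁ (_ , s≡) | inj₂ (_ , t≡) = inj₂ (a≡0 , proj₁ eqs , d≡ , s≡2+t)
    where
    shift : n + (2 + slope n b d) ≡ suc b + suc d
    shift = begin
      n + (2 + slope n b d)  ≡⟨ +-comm n _ ⟩
      2 + slope n b d + n    ≡⟨ cong (2 +_) (trans (+-comm _ n) t≡) ⟩
      2 + (b + d)            ≡⟨ cong suc (+-suc b d) ⟨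
      suc b + suc d          ∎
      where open ≡-Reasoning
    swap : n + (a + c) ≡ c + (n + a)
    swap = trans (sym (+-assoc n a c)) (+-comm (n + a) c)
    eqs = squeeze b<c (≤-trans d<n (m≤m+n n a)) (begin
      c + (n + a)            ≡⟨ swap ⟨
      n + (a + c)            ≡⟨ cong (n +_) s≡ ⟨
      n + slope n a c        ≤⟨ +-monoʳ-≤ n s≤2+t ⟩
      n + (2 + slope n b d)  ≡⟨ shift ⟩
      suc b + suc d          ∎)
      where open ≤-Reasoning
    a≡0 : a ≡ 0
    a≡0 = n≤0⇒n≡0 (+-cancelˡ-≤ n a 0
      (subst₂ _≤_ (proj₂ eqs) (sym (+-identityʳ n)) d<n))
    d≡ : suc d ≡ n
    d≡ = trans (proj₂ eqs) (trans (cong (n +_) a≡0) (+-identityʳ n))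
    s≡2+t = +-cancelˡ-≡ n _ _ (trans (cong (n +_) s≡) (trans swap
      (trans (sym (cong₂ _+_ (proj₁ eqs) (proj₂ eqs))) (sym shift))))

  -- Zigzags formed by two consecutive slopes.

  -- The number of sides of the polygon that the chord i j cuts off, counted on a
  -- fixed side of the parallel class of its slope.
  Cuts : (n ℓ i j : ℕ) → Set
  Cuts n ℓ i j = (i + j < n × i + ℓ ≡ j) ⊎ (n ≤ i + j × j + ℓ ≡ n + i)

  cuts-unique : ∀ {n ℓ ℓ′ i j} → Cuts n ℓ i j → Cuts n ℓ′ i j → ℓ ≡ ℓ′
  cuts-unique {i = i} (inj₁ (_ , eq)) (inj₁ (_ , eq′)) = +-cancelˡ-≡ i _ _ (trans eq (sym eq′))
  cuts-unique {j = j} (inj₂ (_ , eq)) (inj₂ (_ , eq′)) = +-cancelˡ-≡ j _ _ (trans eq (sym eq′))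
  cuts-unique (inj₁ (lt , _)) (inj₂ (ge , _)) = contradiction ge (<⇒≱ lt)
  cuts-unique (inj₂ (ge , _)) (inj₁ (lt , _)) = contradiction ge (<⇒≱ lt)

  ≡⇒≤ : ∀ {m n} o → m + o ≡ n → m ≤ n
  ≡⇒≤ o eq = ≤-trans (m≤m+n _ o) (≤-reflexive eq)

  -- n = 3 + p, and the chord cuts off 2 + a sides, so that a < p is the range of
  -- the diagonals.
  Zigzag : (p s a : ℕ) → Set
  Zigzag p s a = ∃[ i ] ∃[ j ] (Diagonal (3 + p) i j × j < 3 + p ×
    (slope (3 + p) i j ≡ s ⊎ slope (3 + p) i j ≡ suc s) × Cuts (3 + p) (2 + a) i j)

  -- Without wrap-around a chord cutting off `2 + a` sides has `i + j = 2 i + (2 + a)`, so parity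
  -- decides which of `s` and `suc s` is its slope. The start `i` is half of `suc s - (2 + a)`,
  -- rounded down.
  zigzag-low : ∀ {p s a} → a < p → suc s < 3 + p → 2 + a ≤ suc s → Zigzag p s a
  zigzag-low {p} {s} {a} a<p s<n 2+a≤1+s
    with x , eq ← m≤n⇒∃[o]m+o≡n 2+a≤1+s
    with h , parity ← halve x =
    h , h + (2 + a)
    -- The side from `0` to `2 + p` would need `a ≡ p`.
    , (≡⇒≤ a (diag h a) , λ { (refl , 3+a≡) → <-irrefl (+-cancelˡ-≡ 3 _ _ 3+a≡) a<p })
    , ≤-<-trans (m≤n+m _ h) i+j<n
    , slopes parity
    , inj₁ (i+j<n , refl)
    where
    diag : ∀ h a → 2 + h + a ≡ h + (2 + a)
    diag = solve-∀
    rearrange : ∀ h a → h + (h + (2 + a)) ≡ 2 + a + (h + h)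
    rearrange = solve-∀
    i+j≡ : x ≡ h + h ⊎ x ≡ suc (h + h) → h + (h + (2 + a)) ≡ s ⊎ h + (h + (2 + a)) ≡ suc s
    i+j≡ (inj₁ refl) = inj₂ (trans (rearrange h a) eq)
    i+j≡ (inj₂ refl) = inj₁ (trans (rearrange h a) (suc-injective (trans (sym (+-suc (2 + a) (h + h))) eq)))
    i+j<n : h + (h + (2 + a)) < 3 + p
    i+j<n with i+j≡ parity
    ... | inj₁ i+j≡s  = subst (_< 3 + p) (sym i+j≡s) (<⇒≤ s<n)
    ... | inj₂ i+j≡ss = subst (_< 3 + p) (sym i+j≡ss) s<n
    slopes : _ → _
    slopes parity with i+j≡ parity
    ... | inj₁ i+j≡s  = inj₁ (trans (m<n⇒m%n≡m i+j<n) i+j≡s)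
    ... | inj₂ i+j≡ss = inj₂ (trans (m<n⇒m%n≡m i+j<n) i+j≡ss)

  -- Here the endpoint sum wraps around, and cutting off `2 + a` sides means `j = i + (2 + y)` with
  -- `p = suc a + y`. Solving `i + j = n + s` for `i` requires `x = a - s` to be even, and solving
  -- `i + j = n + suc s` requires it to be odd; hence the two witnesses.
  zigzag-high : ∀ {p s a} → a < p → suc s < 3 + p → s ≤ a → Zigzag p s a
  zigzag-high {s = s} a<p s<n s≤a
    with x , refl ← m≤n⇒∃[o]m+o≡n s≤a
    with y , refl ← m≤n⇒∃[o]m+o≡n a<p
    with halve x
  ... | h , inj₁ refl =
    suc s + h , suc s + h + (2 + y)
    , (≡⇒≤ y (diag (suc s + h) y) , λ ())
    , ≡⇒≤ h (bound s h y)
    , inj₁ (trans (cong (_% N) (sum s h y)) ([n+m]%n≡m (<⇒≤ s<n)))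
    , inj₂ (≡⇒≤ s (sym (sum s h y)) , cuts s h y)
    where
    N = 3 + (suc (s + (h + h)) + y)
    diag : ∀ i y → 2 + i + y ≡ i + (2 + y)
    diag = solve-∀
    bound : ∀ s h y → suc (suc s + h + (2 + y)) + h ≡ 3 + (suc (s + (h + h)) + y)
    bound = solve-∀
    sum : ∀ s h y → suc s + h + (suc s + h + (2 + y)) ≡ 3 + (suc (s + (h + h)) + y) + s
    sum = solve-∀
    cuts : ∀ s h y → suc s + h + (2 + y) + (2 + (s + (h + h))) ≡ 3 + (suc (s + (h + h)) + y) + (suc s + h)
    cuts = solve-∀
  ... | h , inj₂ refl =
    2 + s + h , 2 + s + h + (2 + y)
    , (≡⇒≤ y (diag (2 + s + h) y) , λ ())
    , ≡⇒≤ h (bound s h y)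
    , inj₂ (trans (cong (_% N) (sum s h y)) ([n+m]%n≡m s<n))
    , inj₂ (≡⇒≤ (suc s) (sym (sum s h y)) , cuts s h y)
    where
    N = 3 + (suc (s + suc (h + h)) + y)
    diag : ∀ i y → 2 + i + y ≡ i + (2 + y)
    diag = solve-∀
    bound : ∀ s h y → suc (2 + s + h + (2 + y)) + h ≡ 3 + (suc (s + suc (h + h)) + y)
    bound = solve-∀
    sum : ∀ s h y → 2 + s + h + (2 + s + h + (2 + y)) ≡ 3 + (suc (s + suc (h + h)) + y) + suc s
    sum = solve-∀
    cuts : ∀ s h y → 2 + s + h + (2 + y) + (2 + (s + suc (h + h))) ≡ 3 + (suc (s + suc (h + h)) + y) + (2 + s + h)
    cuts = solve-∀

  zigzag : ∀ {p s a} → a < p → suc s < 3 + p → Zigzag p s a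
  zigzag {s = s} {a} a<p s<n with 2 + a ≤? suc s
  ... | yes 2+a≤1+s = zigzag-low a<p s<n 2+a≤1+s
  ... | no  2+a≰1+s = zigzag-high a<p s<n (s≤s⁻¹ (s≤s⁻¹ (≰⇒> 2+a≰1+s)))

  -- Colouring by blocks of consecutive slopes.

  -- The slopes are split into consecutive blocks [first c , first (suc c)) of two
  -- or three slopes each, one block per colour.
  module Blocks (first : ℕ → ℕ) (first-zero : first 0 ≡ 0)
                (2+first≤ : ∀ c → 2 + first c ≤ first (suc c))
                (≤3+first : ∀ c → first (suc c) ≤ 3 + first c) where

    InBlock : ℕ → ℕ → Set
    InBlock c s = first c ≤ s × s < first (suc c)

    first-mono : ∀ {c d} → c ≤ d → first c ≤ first d
    first-mono {d = zero}  z≤n = ≤-refl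
    first-mono {d = suc d} c≤1+d with m≤n⇒m<n∨m≡n c≤1+d
    ... | inj₁ c<1+d = ≤-trans (first-mono (s≤s⁻¹ c<1+d)) (<⇒≤ (<⇒≤ (2+first≤ d)))
    ... | inj₂ refl  = ≤-refl

    block-unique : ∀ {c d s} → InBlock c s → InBlock d s → c ≡ d
    block-unique {c} {d} (c≤ , <c) (d≤ , <d) with <-cmp c d
    ... | tri≈ _ c≡d _ = c≡d
    ... | tri< c<d _ _ = contradiction (≤-trans (first-mono c<d) d≤) (<⇒≱ <c)
    ... | tri> _ _ d<c = contradiction (≤-trans (first-mono d<c) c≤) (<⇒≱ <d)

    block : ∀ k {s} → s < first k → ∃[ c ] InBlock (toℕ {k} c) s
    block zero    s<0 = contradiction (subst (_ <_) first-zero s<0) n≮0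
    block (suc k) {s} s< with s <? first k
    ... | no s≮   = Fin.fromℕ k , subst (λ c → InBlock c s) (sym (toℕ-fromℕ k)) (≮⇒≥ s≮ , s<)
    ... | yes s<k with c , in-c ← block k s<k =
      Fin.inject₁ c , subst (λ c → InBlock c s) (sym (toℕ-inject₁ c)) in-c

    block-width : ∀ {c s t} → InBlock c s → InBlock c t → t ≤ 2 + s
    block-width {c} (c≤s , _) (_ , t<) =
      s≤s⁻¹ (≤-trans t< (≤-trans (≤3+first c) (+-monoʳ-≤ 3 c≤s)))

    -- A block has at most three slopes, so two of them at distance two are its first and its last.
    block-extremes : ∀ {c s} → InBlock c s → InBlock c (2 + s) → s ≡ first c
    block-extremes {c} (c≤s , _) (_ , 2+s<) =
      ≤-antisym (s≤s⁻¹ (s≤s⁻¹ (s≤s⁻¹ (≤-trans 2+s< (≤3+first c))))) c≤s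

    module _ {k p : ℕ} (first-k : first k ≡ 3 + p) where

      private N = 3 + p

      edgeSlope : Edge N → ℕ
      edgeSlope e = slope N (start e) (end e)

      edgeBlock : ∀ e → ∃[ c ] InBlock (toℕ {k} c) (edgeSlope e)
      edgeBlock e = block k (subst (edgeSlope e <_) (sym first-k) (m%n<n (start e + end e) N))

      slopeColouring : Colouring k N
      slopeColouring e = proj₁ (edgeBlock e)

      Third : ℕ → Set
      Third s = ∃[ c ] (InBlock c s × s ≡ 2 + first c)

      -- The chords `e` and `f` are the diagonal `i j` and its rotation back by one step. In the
      -- second case `i` is `0` and is rotated to the last vertex, so that `i j` is the chord `e`,
      -- which is named first.
      Shifted : Edge N → Edge N → ℕ → ℕ → Set
      Shifted e f i j =
        (suc (start e) ≡ i × suc (end e) ≡ j × start f ≡ i × end f ≡ j) ⊎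
        (start e ≡ 0 × i ≡ 0 × end e ≡ j × suc (start f) ≡ j × suc (end f) ≡ N)

      -- Diagonals are the common targets: those of a third slope receive the crossings, and those
      -- of the first two slopes of a colour receive the `p` indices of its zigzag.
      -- `early-not-third` separates the two kinds.
      Charged : Edge N × Edge N ⊎ Fin k × ℕ → ℕ × ℕ → Set
      Charged (inj₁ (e , f)) (i , j) = Third (slope N i j) × Shifted e f i j
      Charged (inj₂ (c , a)) (i , j) =
        (slope N i j ≡ first (toℕ c) ⊎ slope N i j ≡ suc (first (toℕ c))) × Cuts N (2 + a) i j

      early-inBlock : ∀ {c s} → s ≡ first c ⊎ s ≡ suc (first c) → InBlock c s
      early-inBlock {c} (inj₁ refl) = ≤-refl , <⇒≤ (2+first≤ c)
      early-inBlock {c} (inj₂ refl) = n≤1+n _ , 2+first≤ c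

      early-not-third : ∀ {c s} → s ≡ first c ⊎ s ≡ suc (first c) → ¬ Third s
      early-not-third early (d , in-d , s≡) with block-unique (early-inBlock early) in-d | early
      ... | refl | inj₁ refl = m≢1+n+m _ s≡
      ... | refl | inj₂ refl = m≢1+n+m _ (suc-injective s≡)

      shifted-unique : ∀ {e f e′ f′ i j} → Shifted e f i j → Shifted e′ f′ i j → (e , f) ≡ (e′ , f′)
      shifted-unique (inj₁ (a , b , c , d)) (inj₁ (a′ , b′ , c′ , d′)) =
        cong₂ _,_ (edge-≡ (suc-injective (trans a (sym a′))) (suc-injective (trans b (sym b′))))
                  (edge-≡ (trans c (sym c′)) (trans d (sym d′)))
      shifted-unique (inj₂ (a , _ , b , c , d)) (inj₂ (a′ , _ , b′ , c′ , d′)) =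
        cong₂ _,_ (edge-≡ (trans a (sym a′)) (trans b (sym b′)))
                  (edge-≡ (suc-injective (trans c (sym c′))) (suc-injective (trans d (sym d′))))
      shifted-unique (inj₁ (refl , _)) (inj₂ (_ , () , _))
      shifted-unique (inj₂ (_ , () , _)) (inj₁ (refl , _))

      charged-injective : ∀ {x x′ y} → Charged x y → Charged x′ y → x ≡ x′
      charged-injective {inj₁ _} {inj₁ _} (_ , sh) (_ , sh′) = cong inj₁ (shifted-unique sh sh′)
      charged-injective {inj₁ _} {inj₂ _} (third , _) (early , _) = contradiction third (early-not-third early)
      charged-injective {inj₂ _} {inj₁ _} (early , _) (third , _) = contradiction third (early-not-third early)
      charged-injective {inj₂ _} {inj₂ _} (early , cuts) (early′ , cuts′) = cong inj₂ (cong₂ _,_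
        (toℕ-injective (block-unique (early-inBlock early) (early-inBlock early′)))
        (suc-injective (suc-injective (cuts-unique cuts cuts′))))

      same-block : ∀ {e f} → slopeColouring e ≡ slopeColouring f →
                   ∃[ c ] (InBlock c (edgeSlope e) × InBlock c (edgeSlope f))
      same-block {e} {f} eq =
        toℕ (slopeColouring e) , proj₂ (edgeBlock e) ,
        subst (λ c → InBlock (toℕ c) (edgeSlope f)) (sym eq) (proj₂ (edgeBlock f))

      third : ∀ {c s t} → InBlock c s → InBlock c t → t ≡ 2 + s → Third t
      third in-s in-t refl = _ , in-t , cong (2 +_) (block-extremes in-s in-t)

      -- Slopes in one block differ by at most two, which leaves only the shift by one step. The
      -- target is the chord with the larger slope: `f` in general, `e` when the shift wraps around.
      crossing-charged : ∀ {x} → MonoCrossing slopeColouring x →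
                         ∃[ y ] (y ∈ diagonals p × Charged (inj₁ x) y)
      crossing-charged {e , f} ((a<b , b<c , c<d) , eq)
        with _ , in-e , in-f ← same-block {e} {f} eq
        with crossing-slopes a<b b<c c<d (toℕ<n (hi f)) (block-width in-e in-f) (block-width in-f in-e)
      ... | inj₁ (b≡ , d≡ , t≡) =
        (start f , end f)
        , ∈-diagonals⁺ (≤-trans (s≤s b<c) c<d , λ (b≡0 , _) → n≮0 (subst (start e <_) b≡0 a<b)) (toℕ<n (hi f))
        , third in-e in-f t≡ , inj₁ (b≡ , d≡ , refl , refl)
      ... | inj₂ (a≡0 , c≡ , d≡ , s≡) =
        (start e , end e)
        , ∈-diagonals⁺ (≤-trans (s≤s a<b) b<c , λ (_ , 1+c≡n) → <-irrefl (suc-injective (trans 1+c≡n (sym d≡))) c<d)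
                       (toℕ<n (hi e))
        , third in-f in-e s≡ , inj₂ (a≡0 , a≡0 , refl , c≡ , d≡)

      zigzag-charged : ∀ {c a} → a < p → ∃[ y ] (y ∈ diagonals p × Charged (inj₂ (c , a)) y)
      zigzag-charged {c} {a} a<p
        with i , j , diagonal , j<n , early , cuts ← zigzag a<p
               (≤-trans (2+first≤ (toℕ c)) (≤-trans (first-mono (toℕ<n c)) (≤-reflexive first-k))) =
        (i , j) , ∈-diagonals⁺ diagonal j<n , early , cuts

      -- Crossings and zigzag indices together embed into the diagonals; for this colouring the
      -- result is the reverse of `lower-bound`.
      crossings-slopeColouring : crossings slopeColouring + k * p ≤ length (diagonals p)
      crossings-slopeColouring = begin
        crossings slopeColouring + k * p
          ≡⟨ cong₂ _+_ (length-map inj₁ M)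
               (trans (length-map inj₂ Z) (trans (length-cartesianProduct (allFin k) (upTo p))
                 (cong₂ _*_ (length-tabulate {n = k} id) (length-upTo p)))) ⟨
        length (map inj₁ M) + length (map inj₂ Z)
          ≡⟨ length-++ (map inj₁ M) ⟨
        length (map inj₁ M ++ map inj₂ Z)
          ≤⟨ length-injection Charged (map inj₁ M ++ map inj₂ Z) unique total
               (λ {x} {x′} {y} → charged-injective {x} {x′} {y}) ⟩
        length (diagonals p) ∎
        where
        open ≤-Reasoning
        M : List (Edge N × Edge N)
        M = monoCrossings slopeColouring
        Z : List (Fin k × ℕ)
        Z = cartesianProduct (allFin k) (upTo p)
        disjoint : ∀ {x} → ¬ (x ∈ map inj₁ M × x ∈ map inj₂ Z)
        disjoint (x∈₁ , x∈₂) with ∈-map⁻ inj₁ x∈₁ | ∈-map⁻ inj₂ x∈₂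
        ... | _ , _ , refl | _ , _ , ()
        unique : Unique (map inj₁ M ++ map inj₂ Z)
        unique = Unique.++⁺ (Unique.map⁺ inj₁-injective (monoCrossings! slopeColouring))
          (Unique.map⁺ inj₂-injective (Unique.cartesianProduct⁺ (Unique.allFin⁺ k) (Unique.upTo⁺ p))) disjoint
        total : ∀ {x} → x ∈ map inj₁ M ++ map inj₂ Z → ∃[ y ] (y ∈ diagonals p × Charged x y)
        total x∈ with ∈-++⁻ (map inj₁ M) x∈
        ... | inj₁ x∈₁ with (e , f) , m∈ , refl ← ∈-map⁻ inj₁ x∈₁ =
                crossing-charged {e , f} (∈-monoCrossings⁻ slopeColouring m∈)
        ... | inj₂ x∈₂ with (c , a) , z∈ , refl ← ∈-map⁻ inj₂ x∈₂ =
                zigzag-charged {c} (∈-upTo⁻ (proj₂ (∈-cartesianProduct⁻ (allFin k) (upTo p) z∈)))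

  -- The exact value from the two bounds.

  upper-bound : ∀ {k r p} → r ≤ k → 2 * k + r ≡ 3 + p →
                ∃[ χ ] (crossings {k} {3 + p} χ + k * p ≤ length (diagonals p))
  upper-bound {k} {r} r≤k n≡ = _ , Blocks.crossings-slopeColouring first refl 2+first≤ ≤3+first
    (trans (cong (2 * k +_) (m≥n⇒m⊓n≡n r≤k)) n≡)
    where
    -- The first `r` blocks have three slopes and the remaining ones two, so the `k` blocks cover
    -- exactly `2 * k + r` slopes.
    first : ℕ → ℕ
    first c = 2 * c + c ⊓ r
    double : ∀ c x → 2 * suc c + x ≡ 2 + (2 * c + x)
    double c x = cong (_+ x) (*-suc 2 c)
    2+first≤ : ∀ c → 2 + first c ≤ first (suc c)
    2+first≤ c = ≤-trans (+-monoʳ-≤ (2 + 2 * c) (⊓-monoˡ-≤ r (n≤1+n c))) (≤-reflexive (sym (double c _)))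
    ≤3+first : ∀ c → first (suc c) ≤ 3 + first c
    ≤3+first c = ≤-trans (≤-reflexive (double c _))
      (≤-trans (+-monoʳ-≤ (2 + 2 * c) (⊓-monoʳ-≤ (suc c) (n≤1+n r)))
               (≤-reflexive (cong (2 +_) (+-suc (2 * c) (c ⊓ r)))))

  -- The truncated subtraction is exact, since the colouring attaining the upper bound shows
  -- `c ≤ d`.
  isBookCrossingNumber : ∀ {k n c d} → (∃[ χ ] (crossings {k} {n} χ + c ≤ d)) →
                         (∀ (χ : Colouring k n) → d ≤ c + crossings χ) →
                         IsBookCrossingNumber k n (d ∸ c)
  isBookCrossingNumber {k} {n} {c} {d} (χ , upper) lower =
    (χ , ≤-antisym (m+n≤o⇒m≤o∸n (crossings χ) upper) (d∸c≤ χ)) , d∸c≤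
    where
    d∸c≤ : ∀ (χ : Colouring k n) → d ∸ c ≤ crossings χ
    d∸c≤ χ = m≤n+o⇒m∸n≤o d c (lower χ)

  bookCrossingNumber : ∀ {k r p} → r ≤ k → 2 * k + r ≡ 3 + p →
                       ∃[ ν ] (IsBookCrossingNumber k (3 + p) ν × ν * 2 ≡ p * r)
  bookCrossingNumber {k} {r} {p} r≤k n≡ =
    ν , isBookCrossingNumber (upper-bound r≤k n≡) lower-bound , ν*2≡
    where
    ν = length (diagonals p) ∸ k * p
    ν*2≡ : ν * 2 ≡ p * r
    ν*2≡ = begin
      ν * 2                                     ≡⟨ *-distribʳ-∸ 2 (length (diagonals p)) (k * p) ⟩
      length (diagonals p) * 2 ∸ k * p * 2      ≡⟨ cong (_∸ k * p * 2) (length-diagonals p) ⟩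
      p * (3 + p) ∸ k * p * 2                   ≡⟨ cong (λ n → p * n ∸ k * p * 2) n≡ ⟨
      p * (2 * k + r) ∸ k * p * 2               ≡⟨ cong (_∸ k * p * 2) (expand p k r) ⟩
      k * p * 2 + p * r ∸ k * p * 2             ≡⟨ m+n∸m≡n (k * p * 2) (p * r) ⟩
      p * r                                     ∎
      where
      open ≡-Reasoning
      expand : ∀ p k r → p * (2 * k + r) ≡ k * p * 2 + p * r
      expand = solve-∀

-- Passage to rational hypotheses and the rational formula.

module RationalForm where

  open import Data.Integer as ℤ using (+_)
  import Data.Integer.Properties as ℤ
  open import Data.Nat using (ℕ; suc; _+_; _*_; _∸_; _≤_; _<_; NonZero; s≤s; z≤n)
  open import Data.Nat.Properties
  open import Data.Product using (∃-syntax; _×_; _,_; map₂)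
  open import Data.Rational.Unnormalised as ℚᵘ using (_/_; *<*; *≤*; *≡*; _≃_)
  open import Relation.Binary.PropositionalEquality
    using (_≡_; refl; sym; trans; cong; cong₂; subst; module ≡-Reasoning)

  open BookDrawings using (bookCrossingNumber)

  -- The witnesses `p = n - 3` and `r = n - 2 k` are the two factors of the formula;
  -- cross-multiplication turns the bounds on the quotient into `2 * k < n` and `n ≤ 3 * k`.
  size : ∀ k n .{{_ : NonZero k}} .{{_ : NonZero n}} →
         + 2 / 1 ℚᵘ.< + n / k → + n / k ℚᵘ.≤ + 3 / 1 →
         ∃[ p ] ∃[ r ] (n ≡ 3 + p × r ≤ k × 2 * k + r ≡ 3 + p)
  size k@(suc _) n@(suc _) (*<* (ℤ.+<+ 2k<n*1)) (*≤* (ℤ.+≤+ n*1≤3k))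
    with 2k<n ← subst (2 * k <_) (*-identityʳ n) 2k<n*1
    with n≤3k ← subst (_≤ 3 * k) (*-identityʳ n) n*1≤3k
    with r , refl ← m≤n⇒∃[o]m+o≡n (<⇒≤ 2k<n)
    -- Since `k` is positive, `2 * k < n` gives `3 ≤ n`.
    with p , 3+p≡n ← m≤n⇒∃[o]m+o≡n {3} {2 * k + r} (≤-trans (s≤s (*-monoʳ-≤ 2 (s≤s z≤n))) 2k<n) =
    p , r , sym 3+p≡n , +-cancelˡ-≤ (2 * k) r k (≤-trans n≤3k (≤-reflexive (+-comm k (2 * k)))) , sym 3+p≡n

  value-≃ : ∀ {k p r ν} → ν * 2 ≡ p * r → 2 * k + r ≡ 3 + p →
            + ν / 1 ≃ ((+ (3 + p) ℤ.- + 3) ℤ.* (+ (3 + p) ℤ.- + 2 ℤ.* + k)) / 2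
  value-≃ {k} {p} {r} {ν} ν*2≡ n≡ = *≡* (begin
    + ν ℤ.* + 2                                  ≡⟨ ℤ.pos-* ν 2 ⟨
    + (ν * 2)                                    ≡⟨ cong +_ ν*2≡ ⟩
    + (p * r)                                    ≡⟨ ℤ.pos-* p r ⟩
    + p ℤ.* + r                                  ≡⟨ cong (+ p ℤ.*_) r≡ ⟨
    + p ℤ.* (+ (3 + p) ℤ.- + 2 ℤ.* + k)          ≡⟨ ℤ.*-identityʳ _ ⟨
    -- The goal has `+ (3 + p) ℤ.- + 3` as first factor, which computes to `+ p`.
    + p ℤ.* (+ (3 + p) ℤ.- + 2 ℤ.* + k) ℤ.* + 1  ∎)
    where
    open ≡-Reasoning
    r≡ : + (3 + p) ℤ.- + 2 ℤ.* + k ≡ + r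
    r≡ = begin
      + (3 + p) ℤ.- + 2 ℤ.* + k    ≡⟨ cong₂ ℤ._-_ (cong +_ (sym n≡)) (sym (ℤ.pos-* 2 k)) ⟩
      + (2 * k + r) ℤ.- + (2 * k)  ≡⟨ ℤ.[+m]-[+n]≡m⊖n (2 * k + r) (2 * k) ⟩
      (2 * k + r) ℤ.⊖ 2 * k        ≡⟨ ℤ.⊖-≥ (m≤m+n (2 * k) r) ⟩
      + ((2 * k + r) ∸ 2 * k)      ≡⟨ cong +_ (m+n∸m≡n (2 * k) r) ⟩
      + r                          ∎

  minimum : ∀ {k n} → ∃[ p ] ∃[ r ] (n ≡ 3 + p × r ≤ k × 2 * k + r ≡ 3 + p) →
            ∃[ ν ] (IsBookCrossingNumber k n ν ×
                    + ν / 1 ≃ ((+ n ℤ.- + 3) ℤ.* (+ n ℤ.- + 2 ℤ.* + k)) / 2)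
  minimum {k} (p , r , refl , r≤k , n≡) =
    map₂ (map₂ λ ν*2≡ → value-≃ {k} {p} ν*2≡ n≡) (bookCrossingNumber r≤k n≡)

open import Data.Nat using (ℕ; NonZero)
open import Data.Integer using (+_; _-_; _*_)
open import Data.Rational.Unnormalised using (_/_; _<_; _≤_; _≃_)
open import Data.Product using (∃-syntax; _×_)
open RationalForm using (size; minimum)

theorem9 : ∀ (k n : ℕ) .{{_ : NonZero k}} .{{_ : NonZero n}} →
    + 2 / 1 < + n / k → + n / k ≤ + 3 / 1 →
    ∃[ ν ] IsBookCrossingNumber k n ν ×
    + ν / 1 ≃ ((+ n - + 3) * (+ n - + 2 * + k)) / 2
theorem9 k n 2<n/k n/k≤3 = minimum (size k n 2<n/k n/k≤3)
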